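{- For every positive integer $k$, the graph of a $\{1,2k\}$-leaper on a $(4k+2)\times(4k+2)$ board is Hamiltonian (has a cycle through every vertex exactly once).
   Context: For positive integers $r,s$, the graph of an $\{r,s\}$-leaper on an $m\times n$ board has vertex set $\{(x,y): 0\le x<m,\ 0\le y<n\}$ (integers), with an edge between $(x,y)$ and $(x',y')$ whenever $(x'-x,y'-y)\in\{(\pm r,\pm s),(\pm s,\pm r)\}$. -}

module Defs where

open import Data.Nat using (ℕ; suc; _+_; _*_; _≤_; ∣_-_∣)
open import Data.Fin using (Fin; toℕ)
open import Data.Product using (_×_; _,_)
open import Data.Sum using (_⊎_)
open import Data.List using (List; []; _∷_; length)
open import Data.List.Membership.Propositional using (_∈_)
open import Data.List.Relation.Unary.Unique.Propositional using (Unique)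
open import Relation.Binary.PropositionalEquality using (_≡_)

Square : ℕ → ℕ → Set
Square m n = Fin m × Fin n

LeaperAdj : (r s : ℕ) {m n : ℕ} → Square m n → Square m n → Set
LeaperAdj r s (x , y) (x' , y') =
  (∣ toℕ x - toℕ x' ∣ ≡ r × ∣ toℕ y - toℕ y' ∣ ≡ s)
  ⊎ (∣ toℕ x - toℕ x' ∣ ≡ s × ∣ toℕ y - toℕ y' ∣ ≡ r)

data Path {V : Set} (E : V → V → Set) : List V → Set where
  path-[] : Path E []
  path-[-] : ∀ {v} → Path E (v ∷ [])
  path-∷ : ∀ {u v vs} → E u v → Path E (v ∷ vs) → Path E (u ∷ v ∷ vs)

last : {V : Set} → V → List V → V
last u [] = u
last u (v ∷ vs) = last v vs

record HamiltonianCycle {V : Set} (E : V → V → Set) : Set where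
  constructor hamCycle
  field
    start    : V
    rest     : List V
    long     : 3 ≤ length (start ∷ rest)
    distinct : Unique (start ∷ rest)
    covers   : ∀ v → v ∈ start ∷ rest
    path     : Path E (start ∷ rest)
    closing  : E (last start rest) start

Hamiltonian : {V : Set} → (V → V → Set) → Set
Hamiltonian E = HamiltonianCycle E

LeaperGraph : (r s m n : ℕ) → Square m n → Square m n → Set
LeaperGraph r s m n = LeaperAdj r s {m} {n}

{-# OPTIONS --safe #-}
-- Let s be the longer side of the leap, and call the coordinates 0, 1, s, s+1, 2s, 2s+1 ordinal.
-- Sending 0, …, 5 to them turns a knight's step on the 6 × 6 board into a leaper's step, unless it
-- changes a coordinate by one between 1 and 2 or between 3 and 4.  A knight's tour of the 6 × 6 board
-- is chosen in which exactly eight steps are of the latter kind, and each of them is stretched into a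
-- long walk: four of these walks snake through the rows between ordinal ones, and the other four run
-- along the ordinal rows through the columns between ordinal ones.

module Submission where

open import Defs
open import Data.Bool using (Bool; true; false; not; _xor_; T)
open import Data.Bool.Properties using (not-involutive) renaming (_≟_ to _≟ᵇ_)
open import Data.Empty using (⊥-elim)
open import Data.Fin using (Fin; toℕ)
open import Data.Fin.Patterns
open import Data.Fin.Properties using (toℕ-injective; toℕ<n; all?) renaming (_≟_ to _≟ᶠ_)
open import Data.List using (List; []; _∷_; _++_; [_]; length; map; allFin; cartesianProduct)
open import Data.List.Properties using (∷-injective; length-++; length-map; length-tabulate)
open import Data.List.Membership.Propositional using (_∈_)
open import Data.List.Membership.Propositional.Properties
  using (∈-∃++; ∈-++⁺ˡ; ∈-++⁺ʳ; ∈-map⁻; ∈-allFin; ∈-cartesianProduct⁺)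
import Data.List.Membership.DecPropositional as DecMembership
open import Data.List.Relation.Binary.Permutation.Propositional
  using (_↭_; ↭-refl; ↭-trans; ↭-sym; prep; ↭⇒↭ₛ)
open import Data.List.Relation.Binary.Permutation.Propositional.Properties
  using (shift; ∈-resp-↭; ↭-map-inv; ↭-length)
import Data.List.Relation.Binary.Permutation.Setoid.Properties as ↭-Setoid
open import Data.List.Relation.Binary.Subset.Propositional using (_⊆_)
import Data.List.Relation.Unary.All as All
open import Data.List.Relation.Unary.AllPairs using (_∷_)
open import Data.List.Relation.Unary.Any using (here; there)
open import Data.List.Relation.Unary.Unique.Propositional using (Unique)
import Data.List.Relation.Unary.Unique.Propositional.Properties as Unique
open import Data.Maybe using (Maybe; just; nothing; is-just; to-witness-T; zipWith; _<∣>_)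
open import Data.Nat hiding (parity)
open import Data.Nat.ListAction using (sum)
open import Data.Nat.Properties
open import Data.Nat.Tactic.RingSolver using (solve-∀)
open import Data.Product using (_×_; _,_; proj₁; proj₂; ∃-syntax)
open import Data.Product.Properties using (×-≡,≡→≡; ≡-dec)
open import Data.Sum using (inj₁; inj₂)
open import Function using (_on_)
open import Relation.Binary.Construct.Closure.ReflexiveTransitive using (Star; ε; _◅_; _◅◅_)
open import Relation.Binary.Definitions using (DecidableEquality)
open import Relation.Binary.PropositionalEquality
  using (_≡_; refl; sym; trans; cong; cong₂; subst; subst₂; setoid; module ≡-Reasoning)
open import Relation.Nullary using (Dec; yes; no)
open import Relation.Nullary.Decidable using (from-yes)

-- Duplicate-free lists and permutations.

module _ {A : Set} where

  -- Pigeonhole by induction: deleting one occurrence of the head from `ys` keeps the inclusion,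
  -- because the head does not recur in the tail, and equal lengths leave nothing over at the end.
  unique⊆⇒↭ : {xs ys : List A} → Unique xs → xs ⊆ ys → length xs ≡ length ys → xs ↭ ys
  unique⊆⇒↭ {[]}     {[]} _ _ _ = ↭-refl
  unique⊆⇒↭ {x ∷ xs} {ys} (x∉xs ∷ uniq) xs⊆ys eq
    with as , bs , refl ← ∈-∃++ (xs⊆ys (here refl)) =
    ↭-trans (prep x (unique⊆⇒↭ uniq xs⊆rest (suc-injective (trans eq (↭-length rotated))))) (↭-sym rotated)
    where
    rotated : as ++ [ x ] ++ bs ↭ x ∷ as ++ bs
    rotated = shift x as bs
    xs⊆rest : xs ⊆ as ++ bs
    xs⊆rest v∈xs with ∈-resp-↭ rotated (xs⊆ys (there v∈xs))
    ... | here refl = ⊥-elim (All.lookup x∉xs v∈xs refl)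
    ... | there v∈  = v∈

-- Vertices visited by a walk.

module _ {A : Set} {R : A → A → Set} where

  -- The endpoint is left out, so that concatenation of walks becomes `++` and a closed walk does
  -- not count its base point twice.
  sources : ∀ {p q} → Star R p q → List A
  sources ε           = []
  sources {p} (_ ◅ w) = p ∷ sources w

  sources-◅◅ : ∀ {p q r} (v : Star R p q) (w : Star R q r) → sources (v ◅◅ w) ≡ sources v ++ sources w
  sources-◅◅ ε       w = refl
  sources-◅◅ (_ ◅ v) w = cong (_ ∷_) (sources-◅◅ v w)

  length-◅◅ : ∀ {p q r} (v : Star R p q) (w : Star R q r) →
              length (sources (v ◅◅ w)) ≡ length (sources v) + length (sources w)
  length-◅◅ v w = trans (cong length (sources-◅◅ v w)) (length-++ (sources v))

  ∈-◅◅ˡ : ∀ {p q r} (v : Star R p q) (w : Star R q r) → sources v ⊆ sources (v ◅◅ w)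
  ∈-◅◅ˡ v w rewrite sources-◅◅ v w = ∈-++⁺ˡ

  ∈-◅◅ʳ : ∀ {p q r} (v : Star R p q) (w : Star R q r) → sources w ⊆ sources (v ◅◅ w)
  ∈-◅◅ʳ v w rewrite sources-◅◅ v w = ∈-++⁺ʳ (sources v)

  sources-substˡ : ∀ {p p' q} (eq : p ≡ p') (w : Star R p q) →
                   sources (subst (λ p → Star R p q) eq w) ≡ sources w
  sources-substˡ refl w = refl

  sources-substʳ : ∀ {p q q'} (eq : q ≡ q') (w : Star R p q) →
                   sources (subst (Star R p) eq w) ≡ sources w
  sources-substʳ refl w = refl

  start∈sources : ∀ {p q} (w : Star R p q) → 0 < length (sources w) → p ∈ sources w
  start∈sources (_ ◅ _) _ = here refl

  -- The last step of the walk has no successor in the list; for a closed walk it becomes the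
  -- closing edge of the cycle.
  sources⇒path : ∀ {B : Set} {E : B → B → Set} (f : B → A) → (∀ {b c} → R (f b) (f c) → E b c) →
                 ∀ {p q} (w : Star R p q) {b bs} → sources w ≡ map f (b ∷ bs) →
                 Path E (b ∷ bs) × R (f (last b bs)) q × p ≡ f b
  sources⇒path f lower (e ◅ ε)         {bs = []}     refl = path-[-] , e , refl
  sources⇒path f lower (e ◅ w@(_ ◅ _)) {bs = _ ∷ _} eq
    with refl , eq' ← ∷-injective eq
    with path , closing , refl ← sources⇒path f lower w eq' =
    path-∷ (lower e) path , closing , refl

-- From a closed walk to a Hamiltonian cycle.

Cell : Set
Cell = ℕ × ℕ

coordinates : ∀ {n} → Square n n → Cell
coordinates (x , y) = toℕ x , toℕ y

-- A data type rather than a disjunction, so that the cells of a walk are determined by its steps.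
data LeaperStep (s : ℕ) : Cell → Cell → Set where
  tall : ∀ {x y x' y'} → ∣ x - x' ∣ ≡ 1 → ∣ y - y' ∣ ≡ s → LeaperStep s (x , y) (x' , y')
  wide : ∀ {x y x' y'} → ∣ x - x' ∣ ≡ s → ∣ y - y' ∣ ≡ 1 → LeaperStep s (x , y) (x' , y')

step⇒adjacent : ∀ {s n} {v v' : Square n n} → LeaperStep s (coordinates v) (coordinates v') →
                LeaperAdj 1 s v v'
step⇒adjacent (tall dx dy) = inj₁ (dx , dy)
step⇒adjacent (wide dx dy) = inj₂ (dx , dy)

length-cartesianProduct : ∀ {A B : Set} (xs : List A) (ys : List B) →
                          length (cartesianProduct xs ys) ≡ length xs * length ys
length-cartesianProduct []       ys = refl
length-cartesianProduct (x ∷ xs) ys =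
  trans (length-++ (map (x ,_) ys)) (cong₂ _+_ (length-map (x ,_) ys) (length-cartesianProduct xs ys))

-- The length condition makes a covering walk a permutation of the board, so neither
-- distinctness nor staying on the board has to be checked separately.
closedWalk⇒hamiltonian : ∀ {s n p} → 2 ≤ n → (w : Star (LeaperStep s) p p) →
                         (∀ {x y} → x < n → y < n → (x , y) ∈ sources w) →
                         length (sources w) ≡ n * n →
                         Hamiltonian (LeaperGraph 1 s n n)
-- Inverting the permutation along `coordinates` turns the visited cells back into squares of the
-- board.
closedWalk⇒hamiltonian {s} {n} 2≤n w covers len = assemble (↭-map-inv coordinates board↭walk)
  where
  squares : List (Square n n)
  squares = cartesianProduct (allFin n) (allFin n)

  squares-unique : Unique squares
  squares-unique = Unique.cartesianProduct⁺ (Unique.allFin⁺ n) (Unique.allFin⁺ n)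

  squares-length : length squares ≡ n * n
  squares-length = trans (length-cartesianProduct (allFin n) (allFin n))
                         (cong₂ _*_ (length-tabulate {n = n} _) (length-tabulate {n = n} _))

  coordinates-injective : ∀ {v v' : Square n n} → coordinates v ≡ coordinates v' → v ≡ v'
  coordinates-injective eq =
    ×-≡,≡→≡ (toℕ-injective (cong proj₁ eq) , toℕ-injective (cong proj₂ eq))

  board⊆walk : map coordinates squares ⊆ sources w
  board⊆walk c∈ with (x , y) , _ , refl ← ∈-map⁻ coordinates c∈ = covers (toℕ<n x) (toℕ<n y)

  board↭walk : map coordinates squares ↭ sources w
  board↭walk = unique⊆⇒↭ (Unique.map⁺ coordinates-injective squares-unique) board⊆walk
    (trans (length-map coordinates squares) (trans squares-length (sym len)))

  assemble : (∃[ vs ] sources w ≡ map coordinates vs × squares ↭ vs) → Hamiltonian (LeaperGraph 1 s n n)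
  assemble (vs , eq , squares↭vs) = build vs eq squares↭vs long
    where
    long : 3 ≤ length vs
    long = begin
      3               ≤⟨ s≤s (s≤s (s≤s z≤n)) ⟩
      2 * 2           ≤⟨ *-mono-≤ 2≤n 2≤n ⟩
      n * n           ≡⟨ squares-length ⟨
      length squares  ≡⟨ ↭-length squares↭vs ⟩
      length vs       ∎
      where open ≤-Reasoning
    build : ∀ vs → sources w ≡ map coordinates vs → squares ↭ vs → 3 ≤ length vs →
            Hamiltonian (LeaperGraph 1 s n n)
    build (v ∷ vs) eq σ long
      with path , closing , refl ← sources⇒path {E = LeaperGraph 1 s n n} coordinates step⇒adjacent w eq = record
      { start    = v
      ; rest     = vs
      ; long     = long
      ; distinct = ↭-Setoid.Unique-resp-↭ (setoid _) (↭⇒↭ₛ σ) squares-unique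
      ; covers   = λ { (x , y) → ∈-resp-↭ σ (∈-cartesianProduct⁺ (∈-allFin x) (∈-allFin y)) }
      ; path     = path
      ; closing  = step⇒adjacent closing
      }

-- Distances and the halves of the board.

∣n-1+n∣≡1 : ∀ n → ∣ n - suc n ∣ ≡ 1
∣n-1+n∣≡1 zero    = refl
∣n-1+n∣≡1 (suc n) = ∣n-1+n∣≡1 n

∣1+n-n∣≡1 : ∀ n → ∣ suc n - n ∣ ≡ 1
∣1+n-n∣≡1 n = trans (∣-∣-comm (suc n) n) (∣n-1+n∣≡1 n)

∣m+n-m∣≡n : ∀ m n → ∣ m + n - m ∣ ≡ n
∣m+n-m∣≡n m n = trans (∣-∣-comm (m + n) m) (∣m-m+n∣≡n m n)

module Tour (k : ℕ) where

  -- `width` counts the coordinates strictly between 1 and `s`. As `s` unfolds to `suc k * 2`, its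
  -- evenness is available by computation.
  width s side : ℕ
  width = k * 2
  s     = 2 + width
  side  = 2 + (s + s)

  Walk : Cell → Cell → Set
  Walk = Star (LeaperStep s)

  raise : (ℕ → ℕ) → Bool → ℕ → ℕ
  raise f false n = n
  raise f true  n = f n

  half : Bool → ℕ → ℕ
  half = raise (_+ s)

  next : Bool → ℕ → ℕ
  next = raise suc

  half-flip : ∀ b n → ∣ half b n - half (not b) n ∣ ≡ s
  half-flip false n = ∣m-m+n∣≡n n s
  half-flip true  n = ∣m+n-m∣≡n n s

  half-up : ∀ b n → ∣ half b n - half b (suc n) ∣ ≡ 1
  half-up false n = ∣n-1+n∣≡1 n
  half-up true  n = ∣n-1+n∣≡1 (n + s)

  half-down : ∀ b n → ∣ half b (suc n) - half b n ∣ ≡ 1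
  half-down b n = trans (∣-∣-comm (half b (suc n)) (half b n)) (half-up b n)

  next-up : ∀ b n → ∣ next b n - next b (n + s) ∣ ≡ s
  next-up false n = ∣m-m+n∣≡n n s
  next-up true  n = ∣m-m+n∣≡n n s

  next-down : ∀ b n → ∣ next b (n + s) - next b n ∣ ≡ s
  next-down b n = trans (∣-∣-comm (next b (n + s)) (next b n)) (next-up b n)

  next-flip : ∀ b n → ∣ next b n - next (not b) n ∣ ≡ 1
  next-flip false n = ∣n-1+n∣≡1 n
  next-flip true  n = ∣1+n-n∣≡1 n

  -- zigzag b u is the half of the board, in the y-direction, visited in the u-th column of a row walk
  -- that starts in half b: each step changes x by one and y by s.
  zigzag : Bool → ℕ → Bool
  zigzag b zero    = b
  zigzag b (suc u) = not (zigzag b u)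

  zigzag-even : ∀ b n → zigzag b (n * 2) ≡ b
  zigzag-even b zero    = refl
  zigzag-even b (suc n) = trans (not-involutive _) (zigzag-even b n)

  -- Used to find which of the two snakes on a side of the board passes through a given cell.
  zigzag-surjective : ∀ u c → ∃[ b ] zigzag b u ≡ c
  zigzag-surjective zero    c = c , refl
  zigzag-surjective (suc u) c with b , eq ← zigzag-surjective u (not c) =
    b , trans (cong not eq) (not-involutive c)

  -- Zigzags along rows and snakes.

  leftCell rightCell : Bool → ℕ → ℕ → Cell
  leftCell  b y u = u , half (zigzag b u) y
  rightCell b y u = suc (u + s) , half (zigzag b u) y

  -- A zigzag of `s` steps changes half an even number of times.
  end-left : ∀ b y → leftCell b y s ≡ (s , half b y)
  end-left b y = cong (λ c → s , half c y) (zigzag-even b (suc k))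

  end-right : ∀ b y → rightCell b y s ≡ (suc (s + s) , half b y)
  end-right b y = cong (λ c → suc (s + s) , half c y) (zigzag-even b (suc k))

  leftRow : ∀ b y n → Walk (leftCell b y 0) (leftCell b y n)
  leftRow b y zero    = ε
  leftRow b y (suc n) = leftRow b y n ◅◅ tall (∣n-1+n∣≡1 n) (half-flip (zigzag b n) y) ◅ ε

  rightRow : ∀ b y n → Walk (rightCell b y n) (rightCell b y 0)
  rightRow b y zero    = ε
  rightRow b y (suc n) =
    tall (∣1+n-n∣≡1 (n + s)) (trans (∣-∣-comm (half (not (zigzag b n)) y) _) (half-flip (zigzag b n) y))
    ◅ rightRow b y n

  fullLeftRow : ∀ b y → Walk (0 , half b y) (s , half b y)
  fullLeftRow b y = subst (Walk (0 , half b y)) (end-left b y) (leftRow b y s)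

  fullRightRow : ∀ b y → Walk (suc (s + s) , half b y) (suc s , half b y)
  fullRightRow b y = subst (λ p → Walk p (suc s , half b y)) (end-right b y) (rightRow b y s)

  -- A snake runs through the zigzags of consecutive rows; a step by s in the x-direction brings it
  -- from the end of one zigzag back to the start of the next.
  leftSnake : ∀ b n → Walk (s , half b (2 + n)) (0 , half b 1)
  leftSnake b zero    = wide (∣m+n-m∣≡n 0 s) (half-down b 1) ◅ ε
  leftSnake b (suc n) =
    wide (∣m+n-m∣≡n 0 s) (half-down b (2 + n)) ◅ fullLeftRow b (2 + n) ◅◅ leftSnake b n

  rightSnake : ∀ b n → Walk (suc s , half b 1) (suc (s + s) , half b (2 + n))
  rightSnake b zero    = wide (∣m-m+n∣≡n s s) (half-up b 1) ◅ ε
  rightSnake b (suc n) =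
    rightSnake b n ◅◅ fullRightRow b (2 + n) ◅◅ wide (∣m-m+n∣≡n s s) (half-up b (2 + n)) ◅ ε

  -- Strips through the columns between ordinal ones.

  -- In each half h of the board, in the x-direction, a strip keeps to one row of every pair {r, r+1},
  -- r ∈ {0, s, 2s}: the steps that change h also switch the row of the pair.
  stripCell : Bool → Bool → ℕ → ℕ → Cell
  stripCell f h x r = half h x , next (h xor f) r

  strip-flip : ∀ f h x r → LeaperStep s (stripCell f h x r) (stripCell f (not h) x r)
  strip-flip f false x r = wide (half-flip false x) (next-flip f r)
  strip-flip f true  x r = wide (half-flip true x) (trans (∣-∣-comm (next (not f) r) (next f r)) (next-flip f r))

  strip-↗ : ∀ f h x r → LeaperStep s (stripCell f h x r) (stripCell f h (suc x) (r + s))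
  strip-↗ f h x r = tall (half-up h x) (next-up (h xor f) r)

  strip-↘ : ∀ f h x r → LeaperStep s (stripCell f h x (r + s)) (stripCell f h (suc x) r)
  strip-↘ f h x r = tall (half-up h x) (next-down (h xor f) r)

  strip-↖ : ∀ f h x r → LeaperStep s (stripCell f h (suc x) r) (stripCell f h x (r + s))
  strip-↖ f h x r = tall (half-down h x) (next-up (h xor f) r)

  strip-↙ : ∀ f h x r → LeaperStep s (stripCell f h (suc x) (r + s)) (stripCell f h x r)
  strip-↙ f h x r = tall (half-down h x) (next-down (h xor f) r)

  -- In both halves this takes the strip's cells of pair `s` in column `x` and of pairs 0 and
  -- `s + s` in column `suc x`, then moves on by two columns.
  leftPeriod : ∀ f x → Walk (stripCell f false x s) (stripCell f false (2 + x) s)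
  leftPeriod f x =
      strip-↘ f false x 0
    ◅ strip-flip f false (suc x) 0
    ◅ strip-↖ f true x 0
    ◅ strip-↗ f true x s
    ◅ strip-flip f true (suc x) (s + s)
    ◅ strip-↘ f false (suc x) s
    ◅ ε

  -- This takes exactly the strip cells in columns `suc x` and `2 + x` that `leftPeriod f (suc x)`
  -- leaves free.
  rightPeriod : ∀ f x → Walk (stripCell f true (2 + x) s) (stripCell f true x s)
  rightPeriod f x =
      strip-↙ f true (suc x) 0
    ◅ strip-flip f true (suc x) 0
    ◅ strip-↗ f false (suc x) 0
    ◅ strip-↖ f false (suc x) s
    ◅ strip-flip f false (suc x) (s + s)
    ◅ strip-↙ f true x s
    ◅ ε

  leftStrip : ∀ f n → Walk (stripCell f false 1 0) (stripCell f false (2 + n * 2) s)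
  leftStrip f zero    = strip-↗ f false 1 0 ◅ ε
  leftStrip f (suc n) = leftStrip f n ◅◅ leftPeriod f (2 + n * 2)

  rightPeriods : ∀ f n → Walk (stripCell f true (1 + n * 2) s) (stripCell f true 1 s)
  rightPeriods f zero    = ε
  rightPeriods f (suc n) = rightPeriod f (1 + n * 2) ◅◅ rightPeriods f n

  rightStrip : ∀ f n → Walk (stripCell f true (2 + n * 2) (s + s)) (stripCell f true 1 s)
  rightStrip f n = strip-↙ f true (1 + n * 2) s ◅ rightPeriods f n

  -- Lengths and cells of strips, rows and snakes.

  length-leftStrip : ∀ f n → length (sources (leftStrip f n)) ≡ 1 + n * 6
  length-leftStrip f zero    = refl
  length-leftStrip f (suc n) = begin
    length (sources (leftStrip f n ◅◅ leftPeriod f _))  ≡⟨ length-◅◅ (leftStrip f n) (leftPeriod f _) ⟩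
    length (sources (leftStrip f n)) + 6                ≡⟨ cong (_+ 6) (length-leftStrip f n) ⟩
    1 + n * 6 + 6                                       ≡⟨ +-comm (1 + n * 6) 6 ⟩
    1 + suc n * 6                                       ∎
    where open ≡-Reasoning

  length-rightPeriods : ∀ f n → length (sources (rightPeriods f n)) ≡ n * 6
  length-rightPeriods f zero    = refl
  length-rightPeriods f (suc n) = cong (6 +_) (length-rightPeriods f n)

  length-rightStrip : ∀ f n → length (sources (rightStrip f n)) ≡ 1 + n * 6
  length-rightStrip f n = cong suc (length-rightPeriods f n)

  leftPeriod⊆ : ∀ f {q n} → q < n → sources (leftPeriod f (2 + q * 2)) ⊆ sources (leftStrip f n)
  leftPeriod⊆ f {q} {suc n} q<1+n c∈ with m<1+n⇒m<n∨m≡n q<1+n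
  ... | inj₁ q<n  = ∈-◅◅ˡ (leftStrip f n) (leftPeriod f (2 + n * 2)) (leftPeriod⊆ f q<n c∈)
  ... | inj₂ refl = ∈-◅◅ʳ (leftStrip f n) (leftPeriod f (2 + n * 2)) c∈

  rightPeriod⊆ : ∀ f {q n} → q < n → sources (rightPeriod f (1 + q * 2)) ⊆ sources (rightPeriods f n)
  rightPeriod⊆ f {q} {suc n} q<1+n c∈ with m<1+n⇒m<n∨m≡n q<1+n
  ... | inj₁ q<n  = ∈-◅◅ʳ (rightPeriod f (1 + n * 2)) (rightPeriods f n) (rightPeriod⊆ f q<n c∈)
  ... | inj₂ refl = ∈-◅◅ˡ (rightPeriod f (1 + n * 2)) (rightPeriods f n) c∈

  length-leftRow : ∀ b y n → length (sources (leftRow b y n)) ≡ n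
  length-leftRow b y zero    = refl
  length-leftRow b y (suc n) = begin
    length (sources (leftRow b y (suc n)))  ≡⟨ length-◅◅ (leftRow b y n) _ ⟩
    length (sources (leftRow b y n)) + 1    ≡⟨ cong (_+ 1) (length-leftRow b y n) ⟩
    n + 1                                   ≡⟨ +-comm n 1 ⟩
    suc n                                   ∎
    where open ≡-Reasoning

  length-rightRow : ∀ b y n → length (sources (rightRow b y n)) ≡ n
  length-rightRow b y zero    = refl
  length-rightRow b y (suc n) = cong suc (length-rightRow b y n)

  leftCell∈row : ∀ b y {u n} → u < n → leftCell b y u ∈ sources (leftRow b y n)
  leftCell∈row b y {u} {suc n} u<1+n with m<1+n⇒m<n∨m≡n u<1+n
  ... | inj₁ u<n  = ∈-◅◅ˡ (leftRow b y n) _ (leftCell∈row b y u<n)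
  ... | inj₂ refl = ∈-◅◅ʳ (leftRow b y n) _ (here refl)

  rightCell∈row : ∀ b y {u n} → u < n → rightCell b y (suc u) ∈ sources (rightRow b y n)
  rightCell∈row b y {u} {suc n} u<1+n with m<1+n⇒m<n∨m≡n u<1+n
  ... | inj₁ u<n  = there (rightCell∈row b y u<n)
  ... | inj₂ refl = here refl

  sources-fullLeftRow : ∀ b y → sources (fullLeftRow b y) ≡ sources (leftRow b y s)
  sources-fullLeftRow b y = sources-substʳ (end-left b y) (leftRow b y s)

  sources-fullRightRow : ∀ b y → sources (fullRightRow b y) ≡ sources (rightRow b y s)
  sources-fullRightRow b y = sources-substˡ (end-right b y) (rightRow b y s)

  length-leftSnake : ∀ b n → length (sources (leftSnake b n)) ≡ 1 + n * suc s
  length-leftSnake b zero    = refl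
  length-leftSnake b (suc n) = cong suc (begin
    length (sources (fullLeftRow b (2 + n) ◅◅ leftSnake b n))
      ≡⟨ length-◅◅ (fullLeftRow b (2 + n)) (leftSnake b n) ⟩
    length (sources (fullLeftRow b (2 + n))) + length (sources (leftSnake b n))
      ≡⟨ cong₂ _+_ (trans (cong length (sources-fullLeftRow b (2 + n))) (length-leftRow b (2 + n) s))
                   (length-leftSnake b n) ⟩
    s + (1 + n * suc s)
      ≡⟨ +-suc s (n * suc s) ⟩
    suc n * suc s
      ∎)
    where open ≡-Reasoning

  length-rightSnake : ∀ b n → length (sources (rightSnake b n)) ≡ 1 + n * suc s
  length-rightSnake b zero    = refl
  length-rightSnake b (suc n) = begin
    length (sources (rightSnake b (suc n)))
      ≡⟨ length-◅◅ (rightSnake b n) _ ⟩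
    length (sources (rightSnake b n)) + length (sources (fullRightRow b (2 + n) ◅◅ _))
      ≡⟨ cong₂ _+_ (length-rightSnake b n) (length-◅◅ (fullRightRow b (2 + n)) _) ⟩
    1 + n * suc s + (length (sources (fullRightRow b (2 + n))) + 1)
      ≡⟨ cong (λ l → 1 + n * suc s + (l + 1))
           (trans (cong length (sources-fullRightRow b (2 + n))) (length-rightRow b (2 + n) s)) ⟩
    1 + n * suc s + (s + 1)
      ≡⟨ cong (1 + n * suc s +_) (+-comm s 1) ⟩
    1 + n * suc s + suc s
      ≡⟨ cong suc (+-comm (n * suc s) (suc s)) ⟩
    1 + suc n * suc s
      ∎
    where open ≡-Reasoning

  leftCell∈snake : ∀ b {u i n} → u ≤ s → i < n → leftCell b (2 + i) u ∈ sources (leftSnake b n)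
  leftCell∈snake b {u} {i} {suc n} u≤s i<1+n with m<1+n⇒m<n∨m≡n i<1+n
  ... | inj₁ i<n  = there (∈-◅◅ʳ (fullLeftRow b (2 + n)) (leftSnake b n) (leftCell∈snake b u≤s i<n))
  ... | inj₂ refl with m≤n⇒m<n∨m≡n u≤s
  -- The end of the zigzag is not among its own sources; it is the first source of the remaining
  -- snake.
  ...   | inj₂ refl = there (∈-◅◅ʳ (fullLeftRow b (2 + n)) (leftSnake b n)
    (subst (_∈ sources (leftSnake b n)) (sym (end-left b (2 + n)))
      (start∈sources (leftSnake b n) (subst (0 <_) (sym (length-leftSnake b n)) z<s))))
  ...   | inj₁ u<s  = there (∈-◅◅ˡ (fullLeftRow b (2 + n)) (leftSnake b n)
                        (subst (leftCell b (2 + n) u ∈_) (sym (sources-fullLeftRow b (2 + n))) (leftCell∈row b (2 + n) u<s)))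

  rightCell∈snake : ∀ b {u i n} → u ≤ s → i < n → rightCell b (2 + i) u ∈ sources (rightSnake b n)
  rightCell∈snake b {u} {i} {suc n} u≤s i<1+n with m<1+n⇒m<n∨m≡n i<1+n
  ... | inj₁ i<n  = ∈-◅◅ˡ (rightSnake b n) _ (rightCell∈snake b u≤s i<n)
  -- Right zigzags run towards column 0 of their side, so this cell is the source of the step that
  -- leaves the row.
  rightCell∈snake b {zero}  {i} {suc n} u≤s _ | inj₂ refl =
    ∈-◅◅ʳ (rightSnake b n) _ (∈-◅◅ʳ (fullRightRow b (2 + n)) _ (here refl))
  rightCell∈snake b {suc u} {i} {suc n} u<s _ | inj₂ refl =
    ∈-◅◅ʳ (rightSnake b n) _ (∈-◅◅ˡ (fullRightRow b (2 + n)) _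
      (subst (rightCell b (2 + n) (suc u) ∈_) (sym (sources-fullRightRow b (2 + n))) (rightCell∈row b (2 + n) u<s)))

  -- The 6 × 6 board of marks and its stretched steps.

  Mark : Set
  Mark = Fin 6 × Fin 6

  ordinate : Fin 6 → ℕ
  ordinate 0F = 0
  ordinate 1F = 1
  ordinate 2F = s
  ordinate 3F = suc s
  ordinate 4F = s + s
  ordinate 5F = suc (s + s)

  ⟦_⟧ : Mark → Cell
  ⟦ i , j ⟧ = ordinate i , ordinate j

  -- Snake or strip, left or right, and the parameter `b` or `f`; triples of booleans inherit
  -- decidable equality.
  Stretch : Set
  Stretch = Bool × Bool × Bool

  pattern snakeˡ b = false , false , b
  pattern snakeʳ b = false , true , b
  pattern stripˡ f = true , false , f
  pattern stripʳ f = true , true , f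

  from to : Stretch → Mark
  from (snakeˡ false) = 2F , 2F
  from (snakeˡ true)  = 2F , 4F
  from (snakeʳ false) = 3F , 1F
  from (snakeʳ true)  = 3F , 3F
  from (stripˡ false) = 1F , 0F
  from (stripˡ true)  = 1F , 1F
  from (stripʳ false) = 4F , 5F
  from (stripʳ true)  = 4F , 4F

  to (snakeˡ false) = 0F , 1F
  to (snakeˡ true)  = 0F , 3F
  to (snakeʳ false) = 5F , 2F
  to (snakeʳ true)  = 5F , 4F
  to (stripˡ false) = 2F , 2F
  to (stripˡ true)  = 2F , 3F
  to (stripʳ false) = 3F , 3F
  to (stripʳ true)  = 3F , 2F

  -- The endpoints match by computation: `2 + width` is `s`, so each walk starts and ends at ordinal
  -- coordinates.
  stretched : ∀ t → Walk ⟦ from t ⟧ ⟦ to t ⟧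
  stretched (snakeˡ false) = leftSnake false width
  stretched (snakeˡ true)  = leftSnake true width
  stretched (snakeʳ false) = rightSnake false width
  stretched (snakeʳ true)  = rightSnake true width
  stretched (stripˡ false) = leftStrip false k
  stretched (stripˡ true)  = leftStrip true k
  stretched (stripʳ false) = rightStrip false k
  stretched (stripʳ true)  = rightStrip true k

  extra : Stretch → ℕ
  extra (false , _) = width * suc s
  extra (true , _)  = k * 6

  length-stretched : ∀ t → length (sources (stretched t)) ≡ 1 + extra t
  length-stretched (snakeˡ false) = length-leftSnake false width
  length-stretched (snakeˡ true)  = length-leftSnake true width
  length-stretched (snakeʳ false) = length-rightSnake false width
  length-stretched (snakeʳ true)  = length-rightSnake true width
  length-stretched (stripˡ false) = length-leftStrip false k
  length-stretched (stripˡ true)  = length-leftStrip true k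
  length-stretched (stripʳ false) = length-rightStrip false k
  length-stretched (stripʳ true)  = length-rightStrip true k

  -- Expanding a walk of marks into a walk of cells.

  data Edge : Mark → Mark → Set where
    rigid   : ∀ {p q} → LeaperStep s ⟦ p ⟧ ⟦ q ⟧ → Edge p q
    stretch : ∀ t → Edge (from t) (to t)

  expandEdge : ∀ {p q} → Edge p q → Walk ⟦ p ⟧ ⟦ q ⟧
  expandEdge (rigid e)   = e ◅ ε
  expandEdge (stretch t) = stretched t

  expand : ∀ {p q} → Star Edge p q → Walk ⟦ p ⟧ ⟦ q ⟧
  expand ε       = ε
  expand (e ◅ w) = expandEdge e ◅◅ expand w

  stretches : ∀ {p q} → Star Edge p q → List Stretch
  stretches ε               = []
  stretches (rigid _ ◅ w)   = stretches w
  stretches (stretch t ◅ w) = t ∷ stretches w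

  -- Every edge contributes its starting mark, and a stretched edge `extra t` cells more.
  length-expand : ∀ {p q} (w : Star Edge p q) →
                  length (sources (expand w)) ≡ length (sources w) + sum (map extra (stretches w))
  length-expand ε               = refl
  length-expand (rigid _ ◅ w)   = cong suc (length-expand w)
  length-expand (stretch t ◅ w) = begin
    length (sources (stretched t ◅◅ expand w))
      ≡⟨ length-◅◅ (stretched t) (expand w) ⟩
    length (sources (stretched t)) + length (sources (expand w))
      ≡⟨ cong₂ _+_ (length-stretched t) (length-expand w) ⟩
    1 + extra t + (length (sources w) + sum (map extra (stretches w)))
      ≡⟨ rearrange (extra t) (length (sources w)) (sum (map extra (stretches w))) ⟩
    1 + length (sources w) + (extra t + sum (map extra (stretches w)))
      ∎
    where
    open ≡-Reasoning
    rearrange : ∀ a b c → 1 + a + (b + c) ≡ 1 + b + (a + c)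
    rearrange = solve-∀

  mark∈expand : ∀ {p q m} (w : Star Edge p q) → m ∈ sources w → ⟦ m ⟧ ∈ sources (expand w)
  mark∈expand (rigid _ ◅ w)   (here refl) = here refl
  mark∈expand (stretch t ◅ w) (here refl) = ∈-◅◅ˡ (stretched t) (expand w)
    (start∈sources (stretched t) (subst (0 <_) (sym (length-stretched t)) z<s))
  mark∈expand (e ◅ w)         (there m∈)  = ∈-◅◅ʳ (expandEdge e) (expand w) (mark∈expand w m∈)

  stretched⊆expand : ∀ {p q t} (w : Star Edge p q) → t ∈ stretches w →
                     sources (stretched t) ⊆ sources (expand w)
  stretched⊆expand (rigid _ ◅ w)   t∈          c∈ = there (stretched⊆expand w t∈ c∈)
  stretched⊆expand (stretch t ◅ w) (here refl) c∈ = ∈-◅◅ˡ (stretched t) (expand w) c∈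
  stretched⊆expand (stretch t ◅ w) (there t∈)  c∈ =
    ∈-◅◅ʳ (stretched t) (expand w) (stretched⊆expand w t∈ c∈)

  -- Checking a tour of the marks.

  distance-1? : ∀ i j → Maybe (∣ ordinate i - ordinate j ∣ ≡ 1)
  distance-1? 0F 1F = just refl
  distance-1? 2F 3F = just (∣n-1+n∣≡1 s)
  distance-1? 4F 5F = just (∣n-1+n∣≡1 (s + s))
  distance-1? 1F 0F = just refl
  distance-1? 3F 2F = just (∣1+n-n∣≡1 s)
  distance-1? 5F 4F = just (∣1+n-n∣≡1 (s + s))
  distance-1? _  _  = nothing

  distance-s? : ∀ i j → Maybe (∣ ordinate i - ordinate j ∣ ≡ s)
  distance-s? 0F 2F = just (∣m-m+n∣≡n 0 s)
  distance-s? 1F 3F = just (∣m-m+n∣≡n 1 s)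
  distance-s? 2F 4F = just (∣m-m+n∣≡n s s)
  distance-s? 3F 5F = just (∣m-m+n∣≡n (suc s) s)
  distance-s? 2F 0F = just (∣m+n-m∣≡n 0 s)
  distance-s? 3F 1F = just (∣m+n-m∣≡n 1 s)
  distance-s? 4F 2F = just (∣m+n-m∣≡n s s)
  distance-s? 5F 3F = just (∣m+n-m∣≡n (suc s) s)
  distance-s? _  _  = nothing

  -- Only steps valid for every `k` are recognised: 1 and `s`, for instance, are at distance one
  -- only when `k` is 0, and such pairs give `nothing`.
  step? : ∀ p q → Maybe (LeaperStep s ⟦ p ⟧ ⟦ q ⟧)
  step? (i , j) (i' , j') =
    zipWith tall (distance-1? i i') (distance-s? j j')
    <∣> zipWith wide (distance-s? i i') (distance-1? j j')

  infixr 5 _⟶_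

  -- For a recognised step the hidden argument reduces to the unit type and is inferred, so the tour
  -- is verified by type checking with `k` a variable.
  _⟶_ : ∀ p {q r} {_ : T (is-just (step? p q))} → Star Edge q r → Star Edge p r
  _⟶_ p {q} {_} {ok} w = rigid (to-witness-T (step? p q) ok) ◅ w

  -- Found by computer search.
  tour : Star Edge (0F , 0F) (0F , 0F)
  tour =
    (0F , 0F) ⟶ (1F , 2F) ⟶ (0F , 4F) ⟶ (2F , 5F) ⟶ stretch (stripʳ true) ◅
    (3F , 2F) ⟶ (2F , 0F) ⟶ (4F , 1F) ⟶ (5F , 3F) ⟶ stretch (stripʳ false) ◅
    stretch (snakeʳ true) ◅
    (5F , 4F) ⟶ (3F , 5F) ⟶ (1F , 4F) ⟶ (0F , 2F) ⟶ stretch (stripˡ false) ◅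
    stretch (snakeˡ false) ◅
    (0F , 1F) ⟶ (1F , 3F) ⟶ (0F , 5F) ⟶ stretch (snakeˡ true) ◅
    (0F , 3F) ⟶ (1F , 5F) ⟶ (3F , 4F) ⟶ (5F , 5F) ⟶ (4F , 3F) ⟶ (5F , 1F) ⟶
    (3F , 0F) ⟶ stretch (stripˡ true) ◅
    (2F , 3F) ⟶ (4F , 2F) ⟶ (5F , 0F) ⟶ stretch (snakeʳ false) ◅
    (5F , 2F) ⟶ (4F , 0F) ⟶ (2F , 1F) ⟶ ε

  marks : List Mark
  marks = sources tour

  _≟ᵐ_ : DecidableEquality Mark
  _≟ᵐ_ = ≡-dec _≟ᶠ_ _≟ᶠ_

  _≟ˢ_ : DecidableEquality Stretch
  _≟ˢ_ = ≡-dec _≟ᵇ_ (≡-dec _≟ᵇ_ _≟ᵇ_)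

  open DecMembership _≟ᵐ_ using () renaming (_∈?_ to _∈ᵐ?_)
  open DecMembership _≟ˢ_ using () renaming (_∈?_ to _∈ˢ?_)

  marks-complete? : Dec (∀ i j → (i , j) ∈ marks)
  marks-complete? = all? λ i → all? λ j → (i , j) ∈ᵐ? marks

  marks-complete : ∀ i j → (i , j) ∈ marks
  marks-complete = from-yes marks-complete?

  stretch∈tour : ∀ t → t ∈ stretches tour
  stretch∈tour (snakeˡ false) = from-yes (snakeˡ false ∈ˢ? stretches tour)
  stretch∈tour (snakeˡ true)  = from-yes (snakeˡ true ∈ˢ? stretches tour)
  stretch∈tour (snakeʳ false) = from-yes (snakeʳ false ∈ˢ? stretches tour)
  stretch∈tour (snakeʳ true)  = from-yes (snakeʳ true ∈ˢ? stretches tour)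
  stretch∈tour (stripˡ false) = from-yes (stripˡ false ∈ˢ? stretches tour)
  stretch∈tour (stripˡ true)  = from-yes (stripˡ true ∈ˢ? stretches tour)
  stretch∈tour (stripʳ false) = from-yes (stripʳ false ∈ˢ? stretches tour)
  stretch∈tour (stripʳ true)  = from-yes (stripʳ true ∈ˢ? stretches tour)

  -- Cells filled by the stretched walks.

  Filled : Cell → Set
  Filled c = ∃[ t ] c ∈ sources (stretched t)

  leftSnake⇒filled : ∀ b {c} → c ∈ sources (leftSnake b width) → Filled c
  leftSnake⇒filled false c∈ = snakeˡ false , c∈
  leftSnake⇒filled true  c∈ = snakeˡ true , c∈

  rightSnake⇒filled : ∀ b {c} → c ∈ sources (rightSnake b width) → Filled c
  rightSnake⇒filled false c∈ = snakeʳ false , c∈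
  rightSnake⇒filled true  c∈ = snakeʳ true , c∈

  leftStrip⇒filled : ∀ f {c} → c ∈ sources (leftStrip f k) → Filled c
  leftStrip⇒filled false c∈ = stripˡ false , c∈
  leftStrip⇒filled true  c∈ = stripˡ true , c∈

  rightStrip⇒filled : ∀ f {c} → c ∈ sources (rightStrip f k) → Filled c
  rightStrip⇒filled false c∈ = stripʳ false , c∈
  rightStrip⇒filled true  c∈ = stripʳ true , c∈

  row-filled : ∀ {x i} b → x < side → i < width → Filled (x , half b (2 + i))
  row-filled {x} {i} b x<side i<width with x ≤? s
  -- The snake is chosen by the starting half `c` whose zigzag is in half `b` at column `x`.
  ... | yes x≤s with c , refl ← zigzag-surjective x b =
    leftSnake⇒filled c (leftCell∈snake c x≤s i<width)
  ... | no x≰s with u , refl ← m≤n⇒∃[o]m+o≡n (≰⇒> x≰s) with c , refl ← zigzag-surjective u b =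
    rightSnake⇒filled c (subst (λ x → (suc x , half (zigzag c u) (2 + i)) ∈ sources (rightSnake c width))
      (+-comm u s)
      -- Here the column is `suc (s + u)`, and lying below `side` means `u ≤ s`.
      (rightCell∈snake c (+-cancelˡ-≤ s u s (s≤s⁻¹ (s≤s⁻¹ x<side))) i<width))

  data Parity : ℕ → Set where
    even : ∀ q → Parity (q * 2)
    odd  : ∀ q → Parity (suc (q * 2))

  parity : ∀ n → Parity n
  parity zero = even 0
  parity (suc n) with parity n
  ... | even q = odd q
  ... | odd q  = even (suc q)

  leftPeriod-filled : ∀ f {q c} → q < k → c ∈ sources (leftPeriod f (2 + q * 2)) → Filled c
  leftPeriod-filled f q<k c∈ = leftStrip⇒filled f (leftPeriod⊆ f q<k c∈)

  rightPeriod-filled : ∀ f {q c} → q < k → c ∈ sources (rightPeriod f (1 + q * 2)) → Filled c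
  rightPeriod-filled f q<k c∈ = rightStrip⇒filled f (there (rightPeriod⊆ f q<k c∈))

  -- In even columns the left strip takes pair `s` and the right strip pairs 0 and `s + s`; in odd
  -- columns the roles are exchanged.
  stripCell-filled : ∀ f h {i} → i < width →
    Filled (stripCell f h (2 + i) 0) × Filled (stripCell f h (2 + i) s) × Filled (stripCell f h (2 + i) (s + s))
  stripCell-filled f h {i} i<width with parity i
  stripCell-filled f false i<width | even q =
    rightPeriod-filled f q<k (there (there (here refl)))
    , leftPeriod-filled f q<k (here refl)
    , rightPeriod-filled f q<k (there (there (there (there (here refl)))))
    where q<k = *-cancelʳ-< 2 q k i<width
  stripCell-filled f true  i<width | even q =
    rightPeriod-filled f q<k (there (here refl))
    , leftPeriod-filled f q<k (there (there (there (here refl))))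
    , rightPeriod-filled f q<k (there (there (there (there (there (here refl))))))
    where q<k = *-cancelʳ-< 2 q k i<width
  stripCell-filled f false i<width | odd q =
    leftPeriod-filled f q<k (there (here refl))
    , rightPeriod-filled f q<k (there (there (there (here refl))))
    , leftPeriod-filled f q<k (there (there (there (there (there (here refl))))))
    where q<k = *-cancelʳ-< 2 q k (<-trans (n<1+n (q * 2)) i<width)
  stripCell-filled f true  i<width | odd q =
    leftPeriod-filled f q<k (there (there (here refl)))
    , rightPeriod-filled f q<k (here refl)
    , leftPeriod-filled f q<k (there (there (there (there (here refl)))))
    where q<k = *-cancelʳ-< 2 q k (<-trans (n<1+n (q * 2)) i<width)

  -- Row `next g r` in half `h` belongs to the strip with `f` equal to `h xor g`; splitting on `h`
  -- and `g` lets `xor` compute.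
  stripRows-filled : ∀ h g {i} → i < width →
    Filled (half h (2 + i) , next g 0) × Filled (half h (2 + i) , next g s) × Filled (half h (2 + i) , next g (s + s))
  stripRows-filled false g     i<width = stripCell-filled g false i<width
  stripRows-filled true  false i<width = stripCell-filled true true i<width
  stripRows-filled true  true  i<width = stripCell-filled false true i<width

  column-filled : ∀ h {i} j → i < width → Filled (half h (2 + i) , ordinate j)
  column-filled h 0F i<width = proj₁ (stripRows-filled h false i<width)
  column-filled h 1F i<width = proj₁ (stripRows-filled h true i<width)
  column-filled h 2F i<width = proj₁ (proj₂ (stripRows-filled h false i<width))
  column-filled h 3F i<width = proj₁ (proj₂ (stripRows-filled h true i<width))
  column-filled h 4F i<width = proj₂ (proj₂ (stripRows-filled h false i<width))
  column-filled h 5F i<width = proj₂ (proj₂ (stripRows-filled h true i<width))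

  -- Ordinal and intermediate coordinates.

  data Block : ℕ → Set where
    first   : Block 0
    second  : Block 1
    between : ∀ {i} → i < width → Block (2 + i)
    later   : ∀ n → Block (n + s)

  -- Peels off the coordinates below `s`. Applied twice it leaves only the offset from `s + s`,
  -- which on the board is 0 or 1.
  block : ∀ n → Block n
  block 0 = first
  block 1 = second
  block (suc (suc i)) with i <? width
  ... | yes i<width = between i<width
  ... | no i≮width  = subst Block restore (later (i ∸ width))
    where
    restore : i ∸ width + s ≡ 2 + i
    restore = trans (+-suc (i ∸ width) (suc width))
      (cong suc (trans (+-suc (i ∸ width) width) (cong suc (m∸n+n≡m (≮⇒≥ i≮width)))))

  data Position : ℕ → Set where
    ordinal : ∀ j → Position (ordinate j)
    gap     : ∀ h {i} → i < width → Position (half h (2 + i))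

  position : ∀ {n} → n < side → Position n
  position {n} n<side with block n
  ... | first           = ordinal 0F
  ... | second          = ordinal 1F
  ... | between i<width = gap false i<width
  ... | later m with block m
  ...   | first           = ordinal 2F
  ...   | second          = ordinal 3F
  ...   | between i<width = gap true i<width
  ...   | later 0 = ordinal 4F
  ...   | later 1 = ordinal 5F
  -- An offset of at least 2 beyond `s + s` would leave the board.
  ...   | later (suc (suc m)) = ⊥-elim (m+n≮n m (s + s)
          (subst (_< s + s) (+-assoc m s s) (s<s⁻¹ (s<s⁻¹ n<side))))

  -- The closed walk through the whole board.

  walk : Walk ⟦ 0F , 0F ⟧ ⟦ 0F , 0F ⟧
  walk = expand tour

  filled⇒visited : ∀ {c} → Filled c → c ∈ sources walk
  filled⇒visited (t , c∈) = stretched⊆expand tour (stretch∈tour t) c∈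

  -- Snakes fill the rows between ordinal ones, strips fill the other columns of ordinal rows, and
  -- the tour of marks takes the cells with both coordinates ordinal.
  walk-covers : ∀ {x y} → x < side → y < side → (x , y) ∈ sources walk
  walk-covers x<side y<side with position y<side
  ... | gap b i<width = filled⇒visited (row-filled b x<side i<width)
  ... | ordinal j with position x<side
  ...   | gap h i<width = filled⇒visited (column-filled h j i<width)
  ...   | ordinal i     = mark∈expand tour (marks-complete i j)

  length-walk : length (sources walk) ≡ side * side
  length-walk = trans (length-expand tour) (count k)
    where
    -- The 36 marks are followed by the extras of the eight stretches in the order of the tour,
    -- bracketed as `sum` unfolds.
    count : ∀ k → let column = k * 6 ; row = k * 2 * (3 + k * 2) ; n = 2 + ((2 + k * 2) + (2 + k * 2)) in
            36 + (column + (column + (row + (column + (row + (row + (column + (row + 0)))))))) ≡ n * n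
    count = solve-∀

theorem5 : (k : ℕ) → Hamiltonian (LeaperGraph 1 (2 * suc k) (4 * suc k + 2) (4 * suc k + 2))
-- `Tour k` has `suc k * 2` as the longer side of the leap; only the forms of this number and of the
-- board's side need adjusting.
theorem5 k = subst₂ (λ s n → Hamiltonian (LeaperGraph 1 s n n)) (*-comm (suc k) 2) (side≡ k)
  (closedWalk⇒hamiltonian (s≤s (s≤s z≤n)) walk walk-covers length-walk)
  where
  open Tour k
  side≡ : ∀ k → 2 + (suc k * 2 + suc k * 2) ≡ 4 * suc k + 2
  side≡ = solve-∀
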